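{- Let $m\geq 3$ be an integer and let $D$ be a strongly connected digraph with minimum semi-degree $\delta(D)=\min\{\delta^+(D),\delta^-(D)\}\geq m+1$. Then $D$ contains a subdigraph $T$ isomorphic to the out-star $OS_m$ or to the in-star $IS_m$ such that $D-V(T)$ is strongly connected.
   Context: Digraphs are finite, without loops and without parallel arcs. A digraph is strongly connected if for every ordered pair of vertices $x,y$ there is a directed path from $x$ to $y$. $\delta^+(D)$ and $\delta^-(D)$ are the minimum out-degree and minimum in-degree of $D$. $D-V(T)$ is the subdigraph induced by $V(D)\setminus V(T)$. A star is a tree with exactly one vertex (the center) of degree greater than one (so a star of order $m$ requires $m\ge 3$). The out-star $OS_m$ is the digraph obtained from a star of order $m$ by orienting every edge away from the center, i.e. vertices $c,v_1,\dots,v_{m-1}$ and arcs $(c,v_i)$, $i=1,\dots,m-1$. The in-star $IS_m$ is obtained by orienting every edge towards the center, i.e. arcs $(v_i,c)$. -}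

module Defs where

open import Data.Nat using (ℕ; zero; suc; _+_; _∸_; _≤_)
open import Data.Fin using (Fin; zero; suc)
open import Data.Unit using (⊤)
open import Data.Bool using (Bool; true; false; if_then_else_)
open import Data.Product using (Σ; ∃; _×_; _,_)
open import Data.Sum using (_⊎_)
open import Relation.Nullary using (¬_)
open import Relation.Binary.PropositionalEquality using (_≡_; _≢_)
open import Function.Definitions using (Injective)

record Digraph (n : ℕ) : Set where
  field
    arc      : Fin n → Fin n → Bool
    loopless : ∀ v → arc v v ≡ false
open Digraph public

count : ∀ {n} → (Fin n → Bool) → ℕ
count {zero}  p = 0
count {suc n} p = (if p zero then 1 else 0) + count (λ i → p (suc i))

outdeg : ∀ {n} → Digraph n → Fin n → ℕ
outdeg D v = count (λ u → arc D v u)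

indeg : ∀ {n} → Digraph n → Fin n → ℕ
indeg D v = count (λ u → arc D u v)

MinSemiDegreeAtLeast : ∀ {n} → Digraph n → ℕ → Set
MinSemiDegreeAtLeast D k = ∀ v → (k ≤ outdeg D v) × (k ≤ indeg D v)

data PathIn {n} (D : Digraph n) (S : Fin n → Set) : Fin n → Fin n → Set where
  here : ∀ {x} → S x → PathIn D S x x
  step : ∀ {x z y} → S x → arc D x z ≡ true → PathIn D S z y → PathIn D S x y

StronglyConnectedOn : ∀ {n} → Digraph n → (Fin n → Set) → Set
StronglyConnectedOn D S = ∀ x y → S x → S y → PathIn D S x y

AllVertices : ∀ {n} → Fin n → Set
AllVertices _ = ⊤

StronglyConnected : ∀ {n} → Digraph n → Set
StronglyConnected D = StronglyConnectedOn D AllVertices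

-- A star of order m in D: center c and m-1 distinct leaves (all ≠ c).
-- Out-star: arcs c → leaf.  In-star: arcs leaf → c.
record OutStar {n} (D : Digraph n) (m : ℕ) : Set where
  field
    center   : Fin n
    leaf     : Fin (m ∸ 1) → Fin n
    leaf-inj : Injective _≡_ _≡_ leaf
    leaf≢c   : ∀ i → leaf i ≢ center
    arcs     : ∀ i → arc D center (leaf i) ≡ true

record InStar {n} (D : Digraph n) (m : ℕ) : Set where
  field
    center   : Fin n
    leaf     : Fin (m ∸ 1) → Fin n
    leaf-inj : Injective _≡_ _≡_ leaf
    leaf≢c   : ∀ i → leaf i ≢ center
    arcs     : ∀ i → arc D (leaf i) center ≡ true

InStarVerts : ∀ {n k} → Fin n → (Fin k → Fin n) → Fin n → Set
InStarVerts c leaf x = (x ≡ c) ⊎ ∃ λ i → leaf i ≡ x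

RemovalStrong : ∀ {n k} → Digraph n → Fin n → (Fin k → Fin n) → Set
RemovalStrong D c leaf = StronglyConnectedOn D (λ x → ¬ InStarVerts c leaf x)

{-# OPTIONS --safe #-}
-- Grow a strongly connected set B whose complement contains a star, until the
-- star is the whole complement.  To enlarge B, take a shortest ear
-- p₀ → … → pₖ leaving and re-entering B, and look for a star avoiding B and
-- the ear.  If k ≤ 1, a vertex x outside B and the ear has all its
-- out-neighbours or all its in-neighbours outside B (or else is
-- itself a one-vertex ear, avoiding the old star), and at most two of them on the ear.
-- If k ≥ 2, minimality confines the out-neighbours on the ear of any
-- x ∈ N⁺(p₀) ∖ {p₁} to p₀, p₁, p₂.  When one of the arcs x → p₁, x → p₂ is
-- missing, x is the centre of an out-star.  When none is missing, reroute the
-- ear through x instead of p₁: then p₁ is the centre of an in-star with leaves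
-- in N⁺(p₀) ∖ {p₁, x}.
module Submission where

open import Defs
open import Data.Bool using (Bool; true; false; if_then_else_; not; _∨_)
open import Data.Bool.Properties using (¬-not; ∨-zeroʳ) renaming (_≟_ to _≟ᵇ_)
open import Data.Empty using (⊥-elim)
open import Data.Fin using (Fin; zero; suc; _≟_)
open import Data.Fin.Properties using (any?; suc-injective; 0≢1+n)
open import Data.Nat using (ℕ; zero; suc; _≤_; _<_; _+_; z≤n; s≤s)
open import Data.Nat.Induction using (<-wellFounded)
open import Data.Nat.Properties
  using ( ≤-refl; ≤-trans; ≤-reflexive; ≤-pred; +-mono-≤; +-mono-≤-<; +-comm; +-suc; m≤n+m
        ; m<n⇒m<1+n; n<1+n; anyUpTo?)
open import Data.Product using (Σ; ∃; _×_; _,_; proj₁; proj₂)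
open import Data.Sum using (_⊎_; inj₁; inj₂; map₂)
open import Data.Unit using (tt)
open import Function using (_∘_)
open import Function.Definitions using (Injective)
open import Induction.WellFounded using (Acc; acc)
open import Relation.Nullary using (¬_; Dec; yes; no; ⌊_⌋)
open import Relation.Nullary.Decidable using (_×-dec_; _⊎-dec_; ¬?; map′; decidable-stable)
open import Relation.Binary.PropositionalEquality using (_≡_; _≢_; refl; sym; trans; cong; subst)

private
  variable
    n k : ℕ

-- Finite vertex sets as Boolean predicates: counting, selection, insertion.

infix 4 _∈_ _∉_

_∈_ _∉_ : Fin n → (Fin n → Bool) → Set
x ∈ S = S x ≡ true
x ∉ S = S x ≡ false

∈-∉ : ∀ (S : Fin n → Bool) {x} → x ∈ S → x ∉ S → ∀ {A : Set} → A
∈-∉ S x∈S x∉S with () ← trans (sym x∈S) x∉S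

_⊆_ : (S R : Fin n → Bool) → Set
S ⊆ R = ∀ u → u ∈ S → u ∈ R

indicator-mono : ∀ {a b} → (a ≡ true → b ≡ true) → (if a then 1 else 0) ≤ (if b then 1 else 0)
indicator-mono {false} _ = z≤n
indicator-mono {true} a⇒b rewrite a⇒b refl = ≤-refl

indicator≤1 : ∀ a → (if a then 1 else 0) ≤ 1
indicator≤1 false = z≤n
indicator≤1 true  = ≤-refl

count-mono-≤ : {p q : Fin n → Bool} → p ⊆ q → count p ≤ count q
count-mono-≤ {zero}  p⊆q = z≤n
count-mono-≤ {suc n} p⊆q = +-mono-≤ (indicator-mono (p⊆q zero)) (count-mono-≤ (p⊆q ∘ suc))

count-mono-< : {S R : Fin n → Bool} → S ⊆ R → ∀ v → v ∉ S → v ∈ R → count S < count R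
count-mono-< {suc n} S⊆R zero v∉S v∈R rewrite v∉S | v∈R = s≤s (count-mono-≤ (S⊆R ∘ suc))
count-mono-< {suc n} S⊆R (suc v) v∉S v∈R =
  +-mono-≤-< (indicator-mono (S⊆R zero)) (count-mono-< (S⊆R ∘ suc) v v∉S v∈R)

count-except : {p q : Fin n → Bool} (v : Fin n) → (∀ u → u ≢ v → u ∈ p → u ∈ q) →
  count p ≤ suc (count q)
count-except {p = p} {q} zero h =
  +-mono-≤ (indicator≤1 (p zero))
    (≤-trans (count-mono-≤ (λ u → h (suc u) (0≢1+n ∘ sym))) (m≤n+m _ (if q zero then 1 else 0)))
count-except {p = p} {q} (suc v) h =
  ≤-trans
    (+-mono-≤ (indicator-mono (h zero 0≢1+n)) (count-except v (λ u u≢v → h (suc u) (u≢v ∘ suc-injective))))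
    (≤-reflexive (+-suc (if q zero then 1 else 0) _))

_∖_ : (Fin n → Bool) → Fin n → Fin n → Bool
(p ∖ v) u = if ⌊ u ≟ v ⌋ then false else p u

∖⁺ : ∀ {p : Fin n → Bool} {v} u → u ≢ v → u ∈ p → u ∈ p ∖ v
∖⁺ {v = v} u u≢v u∈p with u ≟ v
... | yes u≡v = ⊥-elim (u≢v u≡v)
... | no _    = u∈p

∖⁻ : ∀ {p : Fin n → Bool} {v} u → u ∈ p ∖ v → u ≢ v × u ∈ p
∖⁻ {v = v} u u∈ with u ≟ v
... | no u≢v = u≢v , u∈

count-∖ : ∀ {p : Fin n → Bool} v → suc k ≤ count p → k ≤ count (p ∖ v)
count-∖ v k<p = ≤-pred (≤-trans k<p (count-except v ∖⁺))

select : (p : Fin n → Bool) → k ≤ count p →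
  Σ (Fin k → Fin n) λ f → Injective _≡_ _≡_ f × (∀ i → f i ∈ p)
select {k = zero} p _ = (λ ()) , (λ { {()} }) , λ ()
select {zero} {suc k} p ()
select {suc n} {suc k} p k≤ with p zero in p0
... | false with f , f-inj , f∈ ← select (p ∘ suc) k≤ = suc ∘ f , f-inj ∘ suc-injective , f∈
... | true with f , f-inj , f∈ ← select {k = k} (p ∘ suc) (≤-pred k≤) =
  g , g-inj , λ { zero → p0 ; (suc i) → f∈ i }
  where
  g : Fin (suc k) → Fin (suc n)
  g zero    = zero
  g (suc i) = suc (f i)

  g-inj : Injective _≡_ _≡_ g
  g-inj {zero}  {zero}  _  = refl
  g-inj {suc i} {suc j} eq = cong suc (f-inj (suc-injective eq))

insert : Fin n → (Fin n → Bool) → Fin n → Bool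
insert x S u = ⌊ u ≟ x ⌋ ∨ S u

-- Membership in insert x S is unfolded in the next four lemmas, because
-- unification recovers the Boolean S u but not S.
x∈insert : ∀ (x : Fin n) {b} → ⌊ x ≟ x ⌋ ∨ b ≡ true
x∈insert x with x ≟ x
... | yes _  = refl
... | no x≢x = ⊥-elim (x≢x refl)

∈-insert⁺ : ∀ {a b} → b ≡ true → a ∨ b ≡ true
∈-insert⁺ {a} refl = ∨-zeroʳ a

∈-insert⁻ : ∀ {u x : Fin n} {b} → ⌊ u ≟ x ⌋ ∨ b ≡ true → u ≡ x ⊎ b ≡ true
∈-insert⁻ {u = u} {x} u∈ with u ≟ x
... | yes u≡x = inj₁ u≡x
... | no _    = inj₂ u∈

∉-insert : ∀ {u x : Fin n} {b} → u ≢ x → b ≡ false → ⌊ u ≟ x ⌋ ∨ b ≡ false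
∉-insert {u = u} {x} u≢x u∉S with u ≟ x
... | yes u≡x = ⊥-elim (u≢x u≡x)
... | no _    = u∉S

least : {P : ℕ → Set} → (∀ j → Dec (P j)) → ∀ k → P k → ∃ λ j → P j × (∀ i → i < j → ¬ P i)
least {P} P? k Pk = go k Pk (<-wellFounded k)
  where
  go : ∀ k → P k → Acc _<_ k → ∃ λ j → P j × (∀ i → i < j → ¬ P i)
  go k Pk (acc rs) with anyUpTo? P? k
  ... | yes (j , j<k , Pj) = go j Pj (rs j<k)
  ... | no none = k , Pk , λ i i<k Pi → none (i , i<k , Pi)

-- Paths, strong vertex sets and stars.

module _ {D : Digraph n} where

  PathIn-map : ∀ {S R : Fin n → Set} {x y} → (∀ u → S u → R u) → PathIn D S x y → PathIn D R x y
  PathIn-map S⊆R (here x∈)     = here (S⊆R _ x∈)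
  PathIn-map S⊆R (step x∈ a w) = step (S⊆R _ x∈) a (PathIn-map S⊆R w)

  PathIn-trans : ∀ {S : Fin n → Set} {x y z} → PathIn D S x y → PathIn D S y z → PathIn D S x z
  PathIn-trans (here _)      q = q
  PathIn-trans (step x∈ a p) q = step x∈ a (PathIn-trans p q)

Strong : Digraph n → (Fin n → Bool) → Set
Strong D S = StronglyConnectedOn D (_∈ S)

-- One record holds both orientations, so that the growth argument can carry a star without knowing
-- which one it has. The parameter counts leaves, not vertices; looplessness keeps the leaves off
-- the centre.
record Star (D : Digraph n) (k : ℕ) : Set where
  field
    center   : Fin n
    leaf     : Fin k → Fin n
    leaf-inj : Injective _≡_ _≡_ leaf
    arcs     : (∀ i → arc D center (leaf i) ≡ true) ⊎ (∀ i → arc D (leaf i) center ≡ true)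

open Star

StarVerts : {D : Digraph n} → Star D k → Fin n → Set
StarVerts T = InStarVerts (center T) (leaf T)

starVerts? : ∀ {D : Digraph n} (T : Star D k) w → Dec (StarVerts T w)
starVerts? T w = (w ≟ center T) ⊎-dec any? λ i → leaf T i ≟ w

record StarOutside (D : Digraph n) (k : ℕ) (S : Fin n → Bool) : Set where
  field
    star     : Star D k
    center∉S : center star ∉ S
    leaf∉S   : ∀ i → leaf star i ∉ S

open StarOutside

module _ (D : Digraph n) where

  arc⇒≢ : ∀ {u v} → arc D u v ≡ true → u ≢ v
  arc⇒≢ {u} a refl = ∈-∉ (arc D u) a (loopless D u)

  -- The surplus of two in the count pays for discarding `a` and `b`, the only members of `p` exempt
  -- from the conditions; they may coincide. `p` is independent of `c` because the leaves are once
  -- drawn from the neighbourhood of a vertex other than the centre.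
  starOutside : ∀ {S p : Fin n → Bool} {c} a b → suc (suc k) ≤ count p → c ∉ S →
    (∀ u → u ∈ p → u ≢ a → u ≢ b → u ∉ S) →
    (∀ u → u ∈ p → u ≢ a → u ≢ b → arc D c u ≡ true) ⊎
      (∀ u → u ∈ p → u ≢ a → u ≢ b → arc D u c ≡ true) →
    StarOutside D k S
  starOutside {p = p} {c} a b large c∉S outside oriented
    with f , f-inj , f∈ ← select ((p ∖ a) ∖ b) (count-∖ b (count-∖ a large)) = record
      { star = record { center = c ; leaf = f ; leaf-inj = f-inj ; arcs = orient oriented }
      ; center∉S = c∉S
      ; leaf∉S = restrict outside
      }
    where
    restrict : ∀ {Q : Fin n → Set} → (∀ u → u ∈ p → u ≢ a → u ≢ b → Q u) → ∀ i → Q (f i)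
    restrict h i with u≢b , u∈ ← ∖⁻ {p = p ∖ a} (f i) (f∈ i)
      with u≢a , u∈p ← ∖⁻ {p = p} (f i) u∈ = h (f i) u∈p u≢a u≢b

    orient : _ → _
    orient (inj₁ h) = inj₁ (restrict h)
    orient (inj₂ h) = inj₂ (restrict h)

-- Ears of a vertex set and their absorption.

module Ears (D : Digraph n) (B : Fin n → Bool) where

  Entry : Fin n → Set
  Entry x = ∃ λ b → b ∈ B × arc D b x ≡ true

  -- The arc into B is not counted: Return k x is a walk on k + 1 vertices outside B.
  data Return : ℕ → Fin n → Set where
    exit : ∀ {x b} → x ∉ B → arc D x b ≡ true → b ∈ B → Return zero x
    via  : ∀ {k x z} → x ∉ B → arc D x z ≡ true → Return k z → Return (suc k) x

  Return-∉ : ∀ {x} → Return k x → x ∉ B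
  Return-∉ (exit x∉B _ _) = x∉B
  Return-∉ (via x∉B _ _)  = x∉B

  entry? : ∀ x → Dec (Entry x)
  entry? x = any? λ b → (B b ≟ᵇ true) ×-dec (arc D b x ≟ᵇ true)

  return? : ∀ k x → Dec (Return k x)
  return? zero x = map′
    (λ { (x∉B , _ , a , b∈B) → exit x∉B a b∈B })
    (λ { (exit x∉B a b∈B) → x∉B , _ , a , b∈B })
    ((B x ≟ᵇ false) ×-dec any? λ b → (arc D x b ≟ᵇ true) ×-dec (B b ≟ᵇ true))
  return? (suc k) x = map′
    (λ { (x∉B , _ , a , r) → via x∉B a r })
    (λ { (via x∉B a r) → x∉B , _ , a , r })
    ((B x ≟ᵇ false) ×-dec any? λ z → (arc D x z ≟ᵇ true) ×-dec return? k z)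

  EarOfLength : ℕ → Set
  EarOfLength k = ∃ λ x → Entry x × Return k x

  earOfLength? : ∀ k → Dec (EarOfLength k)
  earOfLength? k = any? λ x → entry? x ×-dec return? k x

  out∉B : ∀ {x u} → x ∉ B → ¬ Return 0 x → arc D x u ≡ true → u ∉ B
  out∉B x∉B no-exit a = ¬-not λ u∈B → no-exit (exit x∉B a u∈B)

  in∉B : ∀ {x u} → ¬ Entry x → arc D u x ≡ true → u ∉ B
  in∉B no-entry a = ¬-not λ u∈B → no-entry (_ , u∈B , a)

  absorb : ∀ {x} → Return k x → Fin n → Bool
  absorb (exit {x} _ _ _) = insert x B
  absorb (via {x = x} _ _ r) = insert x (absorb r)

  ⊆-absorb : ∀ {x} (r : Return k x) → B ⊆ absorb r
  ⊆-absorb (exit _ _ _) u = ∈-insert⁺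
  ⊆-absorb (via _ _ r)  u = ∈-insert⁺ ∘ ⊆-absorb r u

  start∈absorb : ∀ {x} (r : Return k x) → x ∈ absorb r
  start∈absorb (exit {x} _ _ _) = x∈insert x
  start∈absorb (via {x = x} _ _ _) = x∈insert x

  -- Each vertex of the ear after `x` starts a tail of `r`, which is a return of length below `k`. A
  -- vertex without so short a return is therefore none of them.
  ∉-absorb : ∀ {x u} (r : Return k x) → u ∉ B → u ≢ x → (∀ i → i < k → ¬ Return i u) → u ∉ absorb r
  ∉-absorb (exit _ _ _) u∉B u≢x _ = ∉-insert u≢x u∉B
  ∉-absorb {k = suc k} (via _ _ r) u∉B u≢x no-return =
    ∉-insert u≢x (∉-absorb r u∉B (λ { refl → no-return k (n<1+n k) r })
      λ i i<k → no-return i (m<n⇒m<1+n i<k))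

  absorb-returns : ∀ {x} (r : Return k x) v → v ∈ absorb r →
    ∃ λ b → b ∈ B × PathIn D (_∈ absorb r) v b
  absorb-returns r@(exit _ a b∈B) v v∈ with ∈-insert⁻ {u = v} v∈
  ... | inj₁ refl = _ , b∈B , step v∈ a (here (⊆-absorb r _ b∈B))
  ... | inj₂ v∈B  = _ , v∈B , here v∈
  absorb-returns (via {z = z} _ a r) v v∈ with ∈-insert⁻ {u = v} v∈
  ... | inj₁ refl with b , b∈B , p ← absorb-returns r z (start∈absorb r) =
    b , b∈B , step v∈ a (PathIn-map (λ _ → ∈-insert⁺) p)
  ... | inj₂ v∈′ with b , b∈B , p ← absorb-returns r v v∈′ = b , b∈B , PathIn-map (λ _ → ∈-insert⁺) p

  absorb-reached : ∀ {x} (r : Return k x) v → v ∈ absorb r → v ∈ B ⊎ PathIn D (_∈ absorb r) x v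
  absorb-reached (exit _ _ _) v v∈ with ∈-insert⁻ {u = v} v∈
  ... | inj₁ refl = inj₂ (here v∈)
  ... | inj₂ v∈B  = inj₁ v∈B
  absorb-reached (via {x = x} _ a r) v v∈ with ∈-insert⁻ {u = v} v∈
  ... | inj₁ refl = inj₂ (here v∈)
  ... | inj₂ v∈′  = map₂ (step (x∈insert x) a ∘ PathIn-map (λ _ → ∈-insert⁺)) (absorb-reached r v v∈′)

  -- From `u` follow the ear forward into `B`, then cross `B`: directly to `v` if `v` lies there,
  -- otherwise to the tail of the entry arc, and along the ear from its start to `v`.
  absorb-strong : Strong D B → ∀ {x} → Entry x → (r : Return k x) → Strong D (absorb r)
  absorb-strong strong (e , e∈B , a) r u v u∈ v∈
    with b , b∈B , p ← absorb-returns r u u∈ | absorb-reached r v v∈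
  ... | inj₁ v∈B = PathIn-trans p (PathIn-map (⊆-absorb r) (strong b v b∈B v∈B))
  ... | inj₂ q   = PathIn-trans p
    (PathIn-trans (PathIn-map (⊆-absorb r) (strong b e b∈B e∈B)) (step (⊆-absorb r e e∈B) a q))

  path-enters : ∀ {S x y} → PathIn D S x y → x ∈ B → y ∉ B → ∃ λ z → z ∉ B × Entry z
  path-enters (here _) x∈B x∉B = ∈-∉ B x∈B x∉B
  path-enters (step {z = z} _ a p) x∈B y∉B with B z in z?
  ... | true  = path-enters p z? y∉B
  ... | false = z , z? , _ , x∈B , a

  path-returns : ∀ {S x y} → PathIn D S x y → x ∉ B → y ∈ B → ∃ λ k → Return k x
  path-returns (here _) x∉B x∈B = ∈-∉ B x∈B x∉B
  path-returns (step {z = z} _ a p) x∉B y∈B with B z in z?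
  ... | true  = 0 , exit x∉B a z?
  ... | false with k , r ← path-returns p z? y∈B = suc k , via x∉B a r

  -- A path from `b` to `v` has a first vertex `z` outside `B`; a path from `z` back to `b`, cut
  -- where it first meets `B`, completes the ear.
  ear : StronglyConnected D → ∀ {b v} → b ∈ B → v ∉ B → ∃ EarOfLength
  ear strong {b} {v} b∈B v∉B
    with z , z∉B , e ← path-enters (strong b v tt tt) b∈B v∉B
    with k , r ← path-returns (strong z b tt tt) z∉B b∈B = k , z , e , r

  -- The ear is part of the data because it need not be the shortest ear first found: it may be
  -- rerouted, or replaced by a one-vertex ear.
  record Expansion (s : ℕ) : Set where
    constructor expansion
    field
      {length} : ℕ
      {start}  : Fin n
      entry    : Entry start
      return   : Return length start
      outside  : StarOutside D s (absorb return)

  -- Finding an ear and a star that avoids it.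

  module _ {s : ℕ} (deg : MinSemiDegreeAtLeast D (suc (suc s))) where

    -- Since `x` is no one-vertex ear, either no arc leads from `x` into `B`, which gives an
    -- out-star, or none leads from `B` to `x`, which gives an in-star.
    starBeyondPair : ∀ {S x a b} → x ∉ B → ¬ (Entry x × Return 0 x) → x ∉ S →
      (∀ u → u ∉ B → u ≢ a → u ≢ b → u ∉ S) → StarOutside D s S
    starBeyondPair {S} {x} {a} {b} x∉B not-both x∉S S⊆ with return? 0 x
    ... | no no-exit = starOutside D a b (proj₁ (deg x)) x∉S
      (λ u xu → S⊆ u (out∉B x∉B no-exit xu)) (inj₁ λ _ xu _ _ → xu)
    ... | yes ex = starOutside D a b (proj₂ (deg x)) x∉S
      (λ u ux → S⊆ u (in∉B (λ en → not-both (en , ex)) ux)) (inj₂ λ _ ux _ _ → ux)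

    module _ {k p₀ p₁ p₂} (e : Entry p₀) (p₀∉B : p₀ ∉ B) (p₀p₁ : arc D p₀ p₁ ≡ true)
      (p₁∉B : p₁ ∉ B) (p₁p₂ : arc D p₁ p₂ ≡ true) (r₂ : Return k p₂)
      (minimal : ∀ i → i < suc (suc k) → ¬ EarOfLength i) where

      private
        r : Return (suc (suc k)) p₀
        r = via p₀∉B p₀p₁ (via p₁∉B p₁p₂ r₂)

      N⁺∉B : ∀ {u} → arc D p₀ u ≡ true → u ∉ B
      N⁺∉B = out∉B p₀∉B λ r₀ → minimal 0 (s≤s z≤n) (p₀ , e , r₀)

      -- Prefixing the arc from `p₀` to such a return would give an ear shorter than `r`.
      N⁺-no-return : ∀ {u} → arc D p₀ u ≡ true → ∀ i → i < suc k → ¬ Return i u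
      N⁺-no-return p₀u i i≤k ru = minimal (suc i) (s≤s i≤k) (p₀ , e , via p₀∉B p₀u ru)

      -- Every vertex of the tail from `p₂` has a return of length at most `k`, which an
      -- out-neighbour of `p₀` cannot have.
      N⁺∉tail : ∀ {u} → arc D p₀ u ≡ true → u ∉ absorb r₂
      N⁺∉tail p₀u = ∉-absorb r₂ (N⁺∉B p₀u) (λ { refl → N⁺-no-return p₀u k (n<1+n k) r₂ })
        λ i i<k → N⁺-no-return p₀u i (m<n⇒m<1+n i<k)

      -- An arc from `x` to a vertex of the ear beyond `p₂` would give a shortcut from `p₀` through
      -- `x`. Of the three ear vertices left, `p₀` is discarded outright, and `h` ensures that
      -- discarding `a` disposes of both `p₁` and `p₂`.
      outStarAt : ∀ {x} → arc D p₀ x ≡ true → x ≢ p₁ → ∀ a →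
        (∀ u → arc D x u ≡ true → u ≢ a → u ≢ p₁ × u ≢ p₂) → StarOutside D s (absorb r)
      outStarAt {x} p₀x x≢p₁ a h = starOutside D p₀ a (proj₁ (deg x))
        (∉-insert (arc⇒≢ D p₀x ∘ sym) (∉-insert x≢p₁ (N⁺∉tail p₀x)))
        (λ u xu u≢p₀ u≢a → let u≢p₁ , u≢p₂ = h u xu u≢a
                               u∉B = out∉B (N⁺∉B p₀x) (N⁺-no-return p₀x 0 (s≤s z≤n)) xu in
          ∉-insert u≢p₀ (∉-insert u≢p₁ (∉-absorb r₂ u∉B u≢p₂
            λ i i<k ru → N⁺-no-return p₀x (suc i) (s≤s i<k) (via (N⁺∉B p₀x) xu ru))))
        (inj₁ λ _ xu _ _ → xu)

      expand-long : Expansion s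
      expand-long
        with any? (λ x → (arc D p₀ x ≟ᵇ true) ×-dec ¬? (x ≟ p₁) ×-dec
               ¬? ((arc D x p₁ ≟ᵇ true) ×-dec (arc D x p₂ ≟ᵇ true)))
      ... | yes (x , p₀x , x≢p₁ , x↛) = expansion e r out-star
        where
        out-star : StarOutside D s (absorb r)
        out-star with arc D x p₁ ≟ᵇ true
        ... | no x↛p₁ = outStarAt p₀x x≢p₁ p₂ λ u xu u≢p₂ → (λ { refl → x↛p₁ xu }) , u≢p₂
        ... | yes xp₁ = outStarAt p₀x x≢p₁ p₁ λ u xu u≢p₁ → u≢p₁ , λ { refl → x↛ (xp₁ , xu) }
      ... | no none
        -- Only the first of these vertices is used, as the `x` of the rerouting; asking for `suc s`
        -- guarantees that there is one.
        with f , _ , f∈ ← select {k = suc s} (arc D p₀ ∖ p₁) (count-∖ p₁ (proj₁ (deg p₀)))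
        with x≢p₁ , p₀x ← ∖⁻ {p = arc D p₀} (f zero) (f∈ zero) =
          -- The new ear replaces `p₁` by `x`. All other out-neighbours of `p₀` miss it, so only the
          -- centre `p₁` and `x` need discarding as leaves.
          expansion e (via p₀∉B p₀x (via (N⁺∉B p₀x) (proj₂ (joined p₀x x≢p₁)) r₂))
            (starOutside D {p = arc D p₀} p₁ (f zero) (proj₁ (deg p₀)) (avoid p₀p₁ (x≢p₁ ∘ sym))
              (λ u p₀u _ u≢x → avoid p₀u u≢x)
              (inj₂ λ u p₀u u≢p₁ _ → proj₁ (joined p₀u u≢p₁)))
        where
        joined : ∀ {u} → arc D p₀ u ≡ true → u ≢ p₁ → arc D u p₁ ≡ true × arc D u p₂ ≡ true
        joined {u} p₀u u≢p₁ = decidable-stable ((arc D u p₁ ≟ᵇ true) ×-dec (arc D u p₂ ≟ᵇ true))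
          λ u↛ → none (u , p₀u , u≢p₁ , u↛)

        avoid : ∀ {u} → arc D p₀ u ≡ true → u ≢ f zero → u ∉ insert p₀ (insert (f zero) (absorb r₂))
        avoid p₀u u≢x = ∉-insert (arc⇒≢ D p₀u ∘ sym) (∉-insert u≢x (N⁺∉tail p₀u))

    expand-shortest : ∀ {w} → w ∉ B → (T : StarOutside D s B) → ¬ StarVerts (star T) w →
      EarOfLength k → (∀ i → i < k → ¬ EarOfLength i) → Expansion s
    expand-shortest {w = w} w∉B T w∉T (p₀ , e , r@(exit _ _ _)) _
      -- If `w` is itself a one-vertex ear, absorbing it leaves the old star intact. Otherwise `w`
      -- differs from `p₀`, which is such an ear, and becomes the centre of a new star.
      with entry? w ×-dec return? 0 w
    ... | yes (ew , rw@(exit _ _ _)) = expansion ew rw record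
      { star = star T
      ; center∉S = ∉-insert (w∉T ∘ inj₁ ∘ sym) (center∉S T)
      ; leaf∉S = λ i → ∉-insert (λ leaf≡w → w∉T (inj₂ (i , leaf≡w))) (leaf∉S T i)
      }
    ... | no not-both = expansion e r (starBeyondPair {a = p₀} {b = p₀} w∉B not-both
      (∉-insert (λ { refl → not-both (e , r) }) w∉B)
      λ u u∉B u≢p₀ _ → ∉-insert u≢p₀ u∉B)
    expand-shortest _ _ _ (p₀ , e , r@(via {z = p₁} p₀∉B p₀p₁ (exit p₁∉B _ _))) minimal
      -- The centre `x` is an out-neighbour of `p₀` other than `p₁`. By minimality there is no
      -- one-vertex ear, so `p₀` has no arc into `B`, which puts `x` outside `B`, and `x` is no such
      -- ear either.
      with f , _ , f∈ ← select (arc D p₀ ∖ p₁) (count-∖ {k = suc s} p₁ (proj₁ (deg p₀)))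
      with x≢p₁ , p₀x ← ∖⁻ {p = arc D p₀} (f zero) (f∈ zero) =
        expansion e r (starBeyondPair {a = p₀} {b = p₁} x∉B (λ (ex , rx) → minimal 0 ≤-refl (_ , ex , rx))
          (avoid x x∉B (arc⇒≢ D p₀x ∘ sym) x≢p₁) avoid)
      where
      x : Fin n
      x = f zero

      x∉B : x ∉ B
      x∉B = out∉B p₀∉B (λ r₀ → minimal 0 ≤-refl (p₀ , e , r₀)) p₀x

      avoid : ∀ u → u ∉ B → u ≢ p₀ → u ≢ p₁ → u ∉ absorb r
      avoid u u∉B u≢p₀ u≢p₁ = ∉-insert u≢p₀ (∉-insert u≢p₁ u∉B)
    expand-shortest _ _ _ (_ , e , via p₀∉B p₀p₁ (via p₁∉B p₁p₂ r₂)) =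
      expand-long e p₀∉B p₀p₁ p₁∉B p₁p₂ r₂

-- The initial star and the growth of `B`.

starAvoiding : (D : Digraph n) → MinSemiDegreeAtLeast D (suc (suc k)) → ∀ b →
  StarOutside D k (insert b (λ _ → false))
starAvoiding D deg b
  -- Any out-neighbour of `b` serves as centre; only `b` has to be discarded from its
  -- out-neighbours, hence the repeated argument.
  with f , _ , f∈ ← select {k = 1} (arc D b) (≤-trans (s≤s z≤n) (proj₁ (deg b))) =
    starOutside D {p = arc D (f zero)} b b (proj₁ (deg (f zero)))
      (∉-insert (arc⇒≢ D (f∈ zero) ∘ sym) refl)
      (λ u _ u≢b _ → ∉-insert u≢b refl)
      (inj₁ λ _ a _ _ → a)

module _ {D : Digraph n} (connected : StronglyConnected D)
  (deg : MinSemiDegreeAtLeast D (suc (suc k))) where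

  connectivityKeepingStar : (B : Fin n → Bool) → ∃ (_∈ B) → Strong D B → StarOutside D k B →
    Acc _<_ (count (not ∘ B)) → Σ (Star D k) λ T → StronglyConnectedOn D (λ x → ¬ StarVerts T x)
  connectivityKeepingStar B (b , b∈B) strong T (acc rs)
    with any? (λ w → (B w ≟ᵇ false) ×-dec ¬? (starVerts? (star T) w))
  -- Here `B` is exactly the complement of the star, so its strength is the claim.
  ... | no none = star T , λ x y x∉T y∉T →
    PathIn-map B-avoids (strong x y (covers x x∉T) (covers y y∉T))
    where
    covers : ∀ x → ¬ StarVerts (star T) x → x ∈ B
    covers x x∉T = ¬-not λ x∉B → none (x , x∉B , x∉T)

    B-avoids : ∀ u → u ∈ B → ¬ StarVerts (star T) u
    B-avoids u u∈B (inj₁ refl)       = ∈-∉ B u∈B (center∉S T)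
    B-avoids _ u∈B (inj₂ (i , refl)) = ∈-∉ B u∈B (leaf∉S T i)
  ... | yes (w , w∉B , w∉T) =
    connectivityKeepingStar (absorb return)
      (b , ⊆-absorb return b b∈B) (absorb-strong strong entry return) outside
      -- The start of the ear leaves the complement of `B`, which therefore shrinks strictly.
      (rs (count-mono-< not-antitone start
        (cong not (start∈absorb return)) (cong not (Return-∉ return))))
    where
    open Ears D B

    E : Expansion k
    E with _ , _ , ears ← ear connected b∈B w∉B
      with _ , shortest , minimal ← least earOfLength? _ (_ , ears) =
        expand-shortest deg w∉B T w∉T shortest minimal

    open Expansion E

    not-antitone : (not ∘ absorb return) ⊆ (not ∘ B)
    not-antitone u u∉ with B u in u?
    ... | false = refl
    ... | true rewrite ⊆-absorb return u u? = u∉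

theorem4p2 : (m : ℕ) → 3 ≤ m → (n : ℕ) → 1 ≤ n → (D : Digraph n) →
    StronglyConnected D → MinSemiDegreeAtLeast D (m + 1) →
    Σ (OutStar D m) (λ T → RemovalStrong D (OutStar.center T) (OutStar.leaf T))
    ⊎ Σ (InStar D m) (λ T → RemovalStrong D (InStar.center T) (InStar.leaf T))
theorem4p2 (suc k) _ (suc n) _ D connected deg = split
  (connectivityKeepingStar connected deg′ B₀ (zero , refl) strong₀
    (starAvoiding D deg′ zero) (<-wellFounded _))
  where
  -- A star of order `suc k` has `k` leaves, so the degree bound exceeds the number of leaves by
  -- exactly the two that may be discarded.
  deg′ : MinSemiDegreeAtLeast D (suc (suc k))
  deg′ = subst (MinSemiDegreeAtLeast D) (+-comm (suc k) 1) deg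

  B₀ : Fin (suc n) → Bool
  B₀ = insert zero (λ _ → false)

  strong₀ : Strong D B₀
  strong₀ zero zero x∈ _ = here x∈

  split : Σ (Star D k) (λ T → RemovalStrong D (center T) (leaf T)) → _
  split (T , removal) with arcs T
  ... | inj₁ out = inj₁ (record
    { center = center T ; leaf = leaf T ; leaf-inj = leaf-inj T
    ; leaf≢c = λ i → arc⇒≢ D (out i) ∘ sym ; arcs = out } , removal)
  ... | inj₂ in′ = inj₂ (record
    { center = center T ; leaf = leaf T ; leaf-inj = leaf-inj T
    ; leaf≢c = λ i → arc⇒≢ D (in′ i) ; arcs = in′ } , removal)
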